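{- Let $(T_n(X))_{n\ge 0}$ be a Carlitz-type $q$-polynomial sequence with associated real sequence $(a_k)_{k\ge 0}$. Then: 1. The sequence $\left(q^X\,n\,T_{n-1}(X)\right)_{n\ge 0}$ is a Carlitz-type $q$-polynomial sequence with associated real sequence $\left((q-1)\,k\,a_{k-1}\right)_{k\ge 0}$. 2. If $T_0(X)$ is identically zero (i.e. $a_0=0$), then the sequence $\left(\frac{q^{ -X}T_{n+1}(X)}{n+1}\right)_{n\ge 0}$ is a Carlitz-type $q$-polynomial sequence with associated real sequence $\left(\frac{1}{q-1}\,\frac{a_{k+1}}{k+1}\right)_{k\ge 0}$. 3. The sequence $\left(q^{ -X}\left(T_n(X)+(q-1)T_{n+1}(X)\right)\right)_{n\ge 0}$ is a Carlitz-type $q$-polynomial sequence with associated real sequence $(a_{k+1})_{k\ge 0}$. 4. The sequence $\left(n\left(T_{n-1}(X)+(q-1)T_n(X)\right)\right)_{n\ge 0}$ is a Carlitz-type $q$-polynomial sequence with associated real sequence $\left((q-1)\,k\,a_k\right)_{k\ge 0}$.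
   Context: Let $q$ be a positive real number, $q\neq 1$, and put $[X]:=\frac{q^X-1}{q-1}$. A $q$-polynomial is a polynomial in $[X]$ (equivalently, in $q^X$) with real coefficients. A sequence $(T_n(X))_{n\ge 0}$ of $q$-polynomials is called Carlitz-type, with associated real sequence $(a_k)_{k\ge 0}$, if for all integers $n\ge 0$ $$T_n(X)=(q-1)^{ -n}\sum_{k=0}^{n}(-1)^{n-k}\binom{n}{k}a_k\,q^{kX}.$$ Convention: for a real or functional sequence $(f_n)_{n\ge 0}$, expressions such as $n f_{n-1}$ (and $k a_{k-1}$) are understood to be $0$ when the index $n$ (resp. $k$) is $0$. -}

module Defs where

open import Level using (_⊔_; suc)
open import Data.Nat.Base as ℕ using (ℕ; _∸_; _≥_)
open import Data.Nat.Combinatorics using (_C_)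
open import Data.Fin.Base using (Fin; toℕ)
open import Data.Product.Base using (∃-syntax; Σ-syntax; _×_; _,_; proj₁)
open import Data.Sum.Base using (_⊎_; inj₁; inj₂; [_,_]′)
open import Relation.Binary.Core using (Rel; _Preserves_⟶_)
open import Relation.Binary.Structures using (IsStrictPartialOrder)
open import Function.Bundles using (_⇔_; Equivalence)
open import Algebra.Bundles using (CommutativeRing)
open import Algebra.Apartness.Bundles using (HeytingField)
import Algebra.Properties.Ring
import Algebra.Properties.Semiring.Sum
import Algebra.Properties.Semiring.Mult
import Algebra.Properties.Semiring.Exp
import Algebra.Definitions

-- The real numbers, axiomatised as a Cauchy-complete Archimedean ordered
-- Heyting field. Classically these axioms determine ℝ up to unique isomorphism.
-- Constructively, x # y is the positive form of x ≠ y; `tight` makes ¬ (x # y)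
-- equivalent to x ≈ y.

record Reals c ℓ₁ ℓ₂ ℓ₃ : Set (suc (c ⊔ ℓ₁ ⊔ ℓ₂ ⊔ ℓ₃)) where
  infix 4 _<_
  field
    heytingField : HeytingField c ℓ₁ ℓ₂

  open HeytingField heytingField public

  commutativeRing : CommutativeRing c ℓ₁
  commutativeRing = record { isCommutativeRing = isCommutativeRing }

  open CommutativeRing commutativeRing public using (ring; semiring)

  open Algebra.Properties.Semiring.Sum semiring public
    using (sum; sum⁺-syntax)
  open Algebra.Properties.Semiring.Mult semiring public
    using () renaming (_×_ to _·_)
  open Algebra.Properties.Semiring.Exp semiring public
    using (_^_)

  field
    _<_                    : Rel Carrier ℓ₃
    <-isStrictPartialOrder : IsStrictPartialOrder _≈_ _<_
    #⇔<⊎>                  : ∀ {x y} → x # y ⇔ (x < y ⊎ y < x)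
    +-monoˡ-<              : ∀ {x y} z → x < y → x + z < y + z
    *-pos                  : ∀ {x y} → 0# < x → 0# < y → 0# < x * y
    archimedean            : ∀ x → ∃[ n ] x < n · 1#

  -- The bound is on s m - s n for all m, n ≥ N, hence on |s m - s n|.
  IsCauchy : (ℕ → Carrier) → Set (c ⊔ ℓ₃)
  IsCauchy s = ∀ ε → 0# < ε →
    ∃[ N ] (∀ m n → m ≥ N → n ≥ N → s m - s n < ε)

  _ConvergesTo_ : (ℕ → Carrier) → Carrier → Set (c ⊔ ℓ₃)
  s ConvergesTo l = ∀ ε → 0# < ε →
    ∃[ N ] (∀ n → n ≥ N → (s n - l < ε) × (l - s n < ε))

  field
    complete : ∀ s → IsCauchy s → ∃[ l ] s ConvergesTo l

-- x /1+ n is x / (n + 1), and difference⁻¹ of a proof of x # y is 1 / (x - y).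

module Inverses {c ℓ₁ ℓ₂ ℓ₃} (R : Reals c ℓ₁ ℓ₂ ℓ₃) where
  open Reals R
  open Algebra.Definitions _≈_ using (Invertible)
  open Algebra.Properties.Ring ring using (-0#≈0#; -1*x≈-x)
  open IsStrictPartialOrder <-isStrictPartialOrder
    using (<-respˡ-≈; <-respʳ-≈)
    renaming (trans to <-trans; irrefl to <-irrefl)

  private
    Inv : Carrier → Set (c ⊔ ℓ₁)
    Inv = Invertible 1# _*_

    Inv-resp : ∀ {x y} → x ≈ y → Inv x → Inv y
    Inv-resp x≈y (z , zx≈1 , xz≈1) =
      z , trans (*-congˡ (sym x≈y)) zx≈1 , trans (*-congʳ (sym x≈y)) xz≈1

    x-0≈x : ∀ x → x - 0# ≈ x
    x-0≈x x = trans (+-congˡ -0#≈0#) (+-identityʳ x)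

    1#0 : 1# # 0#
    1#0 = invertible⇒#
      (Inv-resp (sym (x-0≈x 1#)) (1# , *-identityˡ 1# , *-identityˡ 1#))

    1<0⇒0<1 : 1# < 0# → 0# < 1#
    1<0⇒0<1 1<0 = <-respʳ-≈ -1*-1≈1 (*-pos 0<-1 0<-1)
      where
      0<-1 : 0# < - 1#
      0<-1 = <-respʳ-≈ (+-identityˡ (- 1#))
               (<-respˡ-≈ (-‿inverseʳ 1#) (+-monoˡ-< (- 1#) 1<0))
      open Algebra.Properties.Ring ring using (-‿involutive)
      -1*-1≈1 : - 1# * - 1# ≈ 1#
      -1*-1≈1 = trans (-1*x≈-x (- 1#)) (-‿involutive 1#)

  0<1 : 0# < 1#
  0<1 = [ 1<0⇒0<1 , (λ p → p) ]′ (Equivalence.to #⇔<⊎> 1#0)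

  0<suc·1 : ∀ n → 0# < ℕ.suc n · 1#
  0<suc·1 ℕ.zero    = <-respʳ-≈ (sym (+-identityʳ 1#)) 0<1
  0<suc·1 (ℕ.suc n) = <-trans (0<suc·1 n)
    (<-respˡ-≈ (+-identityˡ _) (+-monoˡ-< (ℕ.suc n · 1#) 0<1))

  suc·1-invertible : ∀ n → Inv (ℕ.suc n · 1#)
  suc·1-invertible n = Inv-resp (x-0≈x _)
    (#⇒invertible (Equivalence.from #⇔<⊎> (inj₂ (0<suc·1 n))))

  infixl 7 _/1+_
  _/1+_ : Carrier → ℕ → Carrier
  x /1+ n = x * proj₁ (suc·1-invertible n)

  difference⁻¹ : ∀ {x y} → x # y → Carrier
  difference⁻¹ x#y = proj₁ (#⇒invertible x#y)

-- `IsPower R q E` says that E is X ↦ q^X: for q > 0 there is exactly one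
-- continuous homomorphism from (ℝ, +) to (ℝ, *) with value q at 1.

record IsPower {c ℓ₁ ℓ₂ ℓ₃} (R : Reals c ℓ₁ ℓ₂ ℓ₃) (q : Reals.Carrier R)
               (E : Reals.Carrier R → Reals.Carrier R)
               : Set (c ⊔ ℓ₁ ⊔ ℓ₃) where
  open Reals R
  field
    cong       : E Preserves _≈_ ⟶ _≈_
    homo       : ∀ x y → E (x + y) ≈ E x * E y
    base       : E 1# ≈ q
    continuous : ∀ x ε → 0# < ε → ∃[ δ ] (0# < δ ×
                   (∀ y → x - y < δ → y - x < δ →
                     (E x - E y < ε) × (E y - E x < ε)))

module QPolynomials {c ℓ₁ ℓ₂ ℓ₃} (R : Reals c ℓ₁ ℓ₂ ℓ₃) {q : Reals.Carrier R}
                    (q#1 : Reals._#_ R q (Reals.1# R))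
                    (q^_ : Reals.Carrier R → Reals.Carrier R) where
  open Reals R
  open Inverses R public using (_/1+_)
  open Inverses R using (difference⁻¹)

  [q-1]⁻¹ : Carrier
  [q-1]⁻¹ = difference⁻¹ q#1

  [_] : Carrier → Carrier
  [ x ] = (q^ x - 1#) * [q-1]⁻¹

  IsQPolynomial : (Carrier → Carrier) → Set (c ⊔ ℓ₁)
  IsQPolynomial f = ∃[ d ] Σ[ b ∈ (Fin (ℕ.suc d) → Carrier) ]
    (∀ x → f x ≈ ∑[ k ≤ d ] (b k * [ x ] ^ toℕ k))

  carlitz : (ℕ → Carrier) → ℕ → Carrier → Carrier
  carlitz a n x = [q-1]⁻¹ ^ n *
    ∑[ k ≤ n ] ((- 1#) ^ (n ∸ toℕ k) *
                ((n C toℕ k) · (a (toℕ k) * (q^ (toℕ k · x)))))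

  record IsCarlitzType (T : ℕ → Carrier → Carrier) (a : ℕ → Carrier)
                       : Set (c ⊔ ℓ₁) where
    field
      isQPolynomial : ∀ n → IsQPolynomial (T n)
      expansion     : ∀ n x → T n x ≈ carlitz a n x

-- Up to the factor (q - 1)⁻ⁿ, Tₙ(X) is the n-th forward difference at 0 of
-- k ↦ aₖ q^(kX), so everything reduces to two rules for Δ:
--   Δⁿ⁺¹f + Δⁿf = Δⁿ(k ↦ fₖ₊₁)   and   Δⁿ(k ↦ k fₖ₋₁) = n Δⁿ⁻¹f.
-- The first gives part 3 and, by induction on n, the second, which gives
-- part 1. Part 1 applied to the sequence claimed in part 2 returns T itself,
-- and part 1 applied to the sequence of part 3 is part 4. Every Carlitz-type
-- sum is a q-polynomial because q^X = 1 + (q - 1)[X].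
module Submission where

open import Defs
open import Algebra.Bundles using (CommutativeRing)
open import Data.Fin.Base using (Fin; zero; suc; toℕ; fromℕ; inject₁)
open import Data.Fin.Properties using (toℕ-fromℕ; toℕ-inject₁)
open import Data.Nat.Base as ℕ using (ℕ; zero; suc; _∸_; z≤n)
open import Data.Nat.Combinatorics
  using (_C_; nCk≡nC[n∸k]; nCn≡1; k>n⇒nCk≡0; nCk+nC[k+1]≡[n+1]C[k+1])
import Data.Nat.Properties as ℕ
open import Data.Product.Base using (_×_; _,_; Σ-syntax; proj₁; proj₂)
open import Data.Sum.Base using (inj₂)
open import Function.Base using (_∘_)
open import Function.Bundles using (Equivalence)
open import Relation.Binary.PropositionalEquality as ≡ using (_≡_)
open import Relation.Nullary.Decidable using (yes; no)
import Algebra.Properties.CommutativeMonoid.Mult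
import Algebra.Properties.CommutativeMonoid.Sum
import Algebra.Properties.Group
import Algebra.Properties.Ring
import Algebra.Properties.Semiring.Exp
import Algebra.Properties.Semiring.Mult
import Algebra.Properties.Semiring.Sum
import Algebra.Solver.Ring.NaturalCoefficients.Default
import Relation.Binary.Reasoning.Setoid

-- Alternating binomial sums as finite differences.

nC0≡1 : ∀ n → n C 0 ≡ 1
nC0≡1 n = ≡.trans (nCk≡nC[n∸k] {0} {n} z≤n) (nCn≡1 n)

module FiniteDifferences {c ℓ} (K : CommutativeRing c ℓ) where
  open CommutativeRing K hiding (zero)
  open Algebra.Properties.Ring ring using (-1*x≈-x)
  open Algebra.Properties.Group +-group using () renaming (∙-cancelʳ to +-cancelʳ)
  open Algebra.Properties.CommutativeMonoid.Mult +-commutativeMonoid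
    using (×-distrib-+)
  open Algebra.Properties.CommutativeMonoid.Sum +-commutativeMonoid
    using (∑-distrib-+)
  open Algebra.Properties.Semiring.Sum semiring
    using (sum⁺-syntax; sum-cong-≋; sum-init-last; *-distribˡ-sum)
  open Algebra.Properties.Semiring.Mult semiring
    using (×-congʳ; ×-congˡ; ×-homo-+; ×-comm-*) renaming (_×_ to _·_)
  open Algebra.Properties.Semiring.Exp semiring using (_^_; ^-congʳ)
  open Algebra.Solver.Ring.NaturalCoefficients.Default commutativeSemiring
    using (solve; _:=_; _:+_; _:*_)
  open Relation.Binary.Reasoning.Setoid setoid

  ·-zeroʳ : ∀ n → n · 0# ≈ 0#
  ·-zeroʳ zero    = refl
  ·-zeroʳ (suc n) = trans (+-identityˡ _) (·-zeroʳ n)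

  signedTerm : (ℕ → Carrier) → ℕ → ℕ → Carrier
  signedTerm f n k = (- 1#) ^ (n ∸ k) * ((n C k) · f k)

  Δ : (ℕ → Carrier) → ℕ → Carrier
  Δ f n = ∑[ k ≤ n ] signedTerm f n (toℕ k)

  Δ-cong : ∀ {f g} → (∀ k → f k ≈ g k) → ∀ n → Δ f n ≈ Δ g n
  Δ-cong {f} {g} f≈g n =
    sum-cong-≋ {suc n} {signedTerm f n ∘ toℕ} {signedTerm g n ∘ toℕ} λ k →
      *-congˡ (×-congʳ (n C toℕ k) (f≈g (toℕ k)))

  Δ-+-homo : ∀ f g n → Δ (λ k → f k + g k) n ≈ Δ f n + Δ g n
  Δ-+-homo f g n = begin
    Δ (λ k → f k + g k) n
      ≈⟨ sum-cong-≋ {suc n} {signedTerm (λ k → f k + g k) n ∘ toℕ} (split ∘ toℕ) ⟩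
    ∑[ k ≤ n ] (signedTerm f n (toℕ k) + signedTerm g n (toℕ k))
      ≈⟨ ∑-distrib-+ {suc n} (signedTerm f n ∘ toℕ) (signedTerm g n ∘ toℕ) ⟩
    Δ f n + Δ g n ∎
    where
    split : ∀ k → signedTerm (λ k → f k + g k) n k ≈ signedTerm f n k + signedTerm g n k
    split k = trans (*-congˡ (×-distrib-+ (f k) (g k) (n C k))) (distribˡ _ _ _)

  Δ-*-homo : ∀ x f n → Δ (λ k → x * f k) n ≈ x * Δ f n
  Δ-*-homo x f n = begin
    Δ (λ k → x * f k) n                    ≈⟨ sum-cong-≋ {suc n} (λ k → pull (toℕ k)) ⟩
    ∑[ k ≤ n ] (x * signedTerm f n (toℕ k)) ≈⟨ *-distribˡ-sum {suc n} x (signedTerm f n ∘ toℕ) ⟨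
    x * Δ f n                              ∎
    where
    pull : ∀ k → signedTerm (λ k → x * f k) n k ≈ x * signedTerm f n k
    pull k = trans (*-congˡ (sym (×-comm-* (n C k) x (f k))))
      (solve 3 (λ s x y → s :* (x :* y) := x :* (s :* y)) refl _ x _)

  -- Consecutive powers of -1 are opposite; this is the only fact about the signs that the recursion
  -- for `Δ` uses.
  -1^suc-cancels : ∀ n y → (- 1#) ^ n * y + (- 1#) ^ suc n * y ≈ 0#
  -1^suc-cancels n y = begin
    (- 1#) ^ n * y + - 1# * (- 1#) ^ n * y     ≈⟨ +-congˡ (*-assoc _ _ y) ⟩
    (- 1#) ^ n * y + - 1# * ((- 1#) ^ n * y)   ≈⟨ +-congˡ (-1*x≈-x _) ⟩
    (- 1#) ^ n * y - (- 1#) ^ n * y            ≈⟨ -‿inverseʳ _ ⟩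
    0#                                         ∎

  -- Pascal's rule splits `suc n C suc k` into `n C k` and `n C suc k`. The first summand is the
  -- right-hand side; the second meets `signedTerm f n (suc k)` with the opposite sign.
  signedTerm-pascal : ∀ f n k →
    signedTerm f (suc n) (suc k) + signedTerm f n (suc k) ≈ signedTerm (f ∘ suc) n k
  signedTerm-pascal f n k = begin
    s * ((suc n C suc k) · y) + s′ * (C₁ · y)
      ≈⟨ +-congʳ (*-congˡ (×-congˡ (nCk+nC[k+1]≡[n+1]C[k+1] n k))) ⟨
    s * (((n C k) ℕ.+ C₁) · y) + s′ * (C₁ · y)      ≈⟨ +-congʳ (*-congˡ (×-homo-+ y (n C k) C₁)) ⟩
    s * ((n C k) · y + C₁ · y) + s′ * (C₁ · y)
      ≈⟨ solve 4 (λ s s′ u v → s :* (u :+ v) :+ s′ :* v := s :* u :+ (s′ :* v :+ s :* v)) refl s s′ _ _ ⟩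
    s * ((n C k) · y) + (s′ * (C₁ · y) + s * (C₁ · y)) ≈⟨ +-congˡ cancels ⟩
    s * ((n C k) · y) + 0#                          ≈⟨ +-identityʳ _ ⟩
    s * ((n C k) · y)                               ∎
    where
    y s s′ : Carrier
    y  = f (suc k)
    s  = (- 1#) ^ (n ∸ k)
    s′ = (- 1#) ^ (n ∸ suc k)
    C₁ : ℕ
    C₁ = n C suc k
    cancels : s′ * (C₁ · y) + s * (C₁ · y) ≈ 0#
    -- `n ∸ k` is the successor of `n ∸ suc k` only when `k < n`. Otherwise the subtraction
    -- truncates and the signs need not be opposite, but then `n C suc k` is zero.
    cancels with suc k ℕ.≤? n
    ... | yes k<n = trans (+-congˡ (*-congʳ (^-congʳ (- 1#) (ℕ.+-∸-assoc 1 k<n))))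
                          (-1^suc-cancels (n ∸ suc k) (C₁ · y))
    ... | no  k≮n = begin
      s′ * (C₁ · y) + s * (C₁ · y) ≈⟨ +-cong (*-congˡ C₁·y≈0) (*-congˡ C₁·y≈0) ⟩
      s′ * 0# + s * 0#             ≈⟨ +-cong (zeroʳ s′) (zeroʳ s) ⟩
      0# + 0#                      ≈⟨ +-identityˡ 0# ⟩
      0#                           ∎
      where
      C₁·y≈0 : C₁ · y ≈ 0#
      C₁·y≈0 = ×-congˡ (k>n⇒nCk≡0 (ℕ.≰⇒> k≮n))

  -- The column `k = 0`, which Pascal's rule does not reach: both binomials are 1 and the signs are
  -- opposite.
  signedTerm-zero-cancels : ∀ f n → signedTerm f (suc n) 0 + signedTerm f n 0 ≈ 0#
  signedTerm-zero-cancels f n = begin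
    signedTerm f (suc n) 0 + signedTerm f n 0             ≈⟨ +-comm _ _ ⟩
    signedTerm f n 0 + signedTerm f (suc n) 0
      ≈⟨ +-cong (*-congˡ (×-congˡ (nC0≡1 n))) (*-congˡ (×-congˡ (nC0≡1 (suc n)))) ⟩
    (- 1#) ^ n * (1 · f 0) + (- 1#) ^ suc n * (1 · f 0)   ≈⟨ -1^suc-cancels n (1 · f 0) ⟩
    0#                                                    ∎

  -- Summing one step further, over the vanishing term n C (n + 1), gives Δ f n
  -- the same index range as Δ f (suc n).
  Δ-extend : ∀ f n → Δ f n ≈ ∑[ k ≤ suc n ] signedTerm f n (toℕ k)
  Δ-extend f n = begin
    Δ f n                                                    ≈⟨ +-identityʳ _ ⟨
    Δ f n + 0#
      ≈⟨ +-cong (sum-cong-≋ {suc n} λ k → reflexive (≡.cong t (≡.sym (toℕ-inject₁ k)))) (sym last≈0) ⟩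
    ∑[ k ≤ n ] t (toℕ (inject₁ k)) + t (toℕ (fromℕ (suc n))) ≈⟨ sum-init-last {suc n} (t ∘ toℕ) ⟨
    ∑[ k ≤ suc n ] t (toℕ k)                                 ∎
    where
    t : ℕ → Carrier
    t = signedTerm f n
    last≈0 : t (toℕ (fromℕ (suc n))) ≈ 0#
    last≈0 = begin
      t (toℕ (fromℕ (suc n))) ≡⟨ ≡.cong t (toℕ-fromℕ (suc n)) ⟩
      t (suc n)               ≈⟨ *-congˡ (×-congˡ (k>n⇒nCk≡0 (ℕ.n<1+n n))) ⟩
      _ * 0#                  ≈⟨ zeroʳ _ ⟩
      0#                      ∎

  -- Over a common index range the two sums add termwise: the terms at 0 cancel, and each pair at
  -- `suc k` collapses by Pascal's rule to the term at `k` for the shifted sequence.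
  Δ-suc : ∀ f n → Δ f (suc n) + Δ f n ≈ Δ (f ∘ suc) n
  Δ-suc f n = begin
    Δ f (suc n) + Δ f n
      ≈⟨ +-congˡ (Δ-extend f n) ⟩
    ∑[ k ≤ suc n ] signedTerm f (suc n) (toℕ k) + ∑[ k ≤ suc n ] signedTerm f n (toℕ k)
      ≈⟨ ∑-distrib-+ {suc (suc n)} (signedTerm f (suc n) ∘ toℕ) (signedTerm f n ∘ toℕ) ⟨
    ∑[ k ≤ suc n ] (signedTerm f (suc n) (toℕ k) + signedTerm f n (toℕ k))
      ≈⟨ +-cong (signedTerm-zero-cancels f n)
                (sum-cong-≋ {suc n} λ k → signedTerm-pascal f n (toℕ k)) ⟩
    0# + Δ (f ∘ suc) n
      ≈⟨ +-identityˡ _ ⟩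
    Δ (f ∘ suc) n ∎

  -- Induction on `n` for all `f` at once, because the step needs the hypothesis both for `f` and
  -- for `f ∘ suc`.
  Δ-absorb : ∀ f n → Δ (λ k → k · f (k ∸ 1)) n ≈ n · Δ f (n ∸ 1)
  Δ-absorb f zero = begin
    1# * (1 · 0#) + 0# ≈⟨ +-identityʳ _ ⟩
    1# * (1 · 0#)      ≈⟨ *-identityˡ _ ⟩
    1 · 0#             ≈⟨ ·-zeroʳ 1 ⟩
    0#                 ∎
  -- Adding `Δ Df n` to both sides brings the left one into the shape of `Δ-suc`. Since `Df (suc k)`
  -- unfolds to `f k + k · f k`, only the difference of `k · f k` remains to be found.
  Δ-absorb f (suc n) = +-cancelʳ (Δ Df n) _ _ (begin
    Δ Df (suc n) + Δ Df n            ≈⟨ Δ-suc Df n ⟩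
    Δ (λ k → f k + k · f k) n        ≈⟨ Δ-+-homo f (λ k → k · f k) n ⟩
    Δ f n + Δ (λ k → k · f k) n      ≈⟨ +-congˡ Δ[k·f] ⟩
    Δ f n + (n · Δ f n + Δ Df n)     ≈⟨ +-assoc _ _ _ ⟨
    Δ f n + n · Δ f n + Δ Df n       ∎)
    where
    Df : ℕ → Carrier
    Df k = k · f (k ∸ 1)

    -- This writes `k · f k` in the form of `Df` with `f ∘ suc` in place of `f`, so that the
    -- induction hypothesis applies. At 0, where `suc (k ∸ 1)` differs from `k`, the factor `k`
    -- makes both sides zero.
    k·f≈D[f∘suc] : ∀ k → k · f k ≈ k · f (suc (k ∸ 1))
    k·f≈D[f∘suc] zero    = refl
    k·f≈D[f∘suc] (suc k) = refl

    step : ∀ n → n · Δ (f ∘ suc) (n ∸ 1) ≈ n · Δ f n + n · Δ f (n ∸ 1)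
    step zero    = sym (+-identityˡ 0#)
    step (suc n) = begin
      suc n · Δ (f ∘ suc) n               ≈⟨ ×-congʳ (suc n) (Δ-suc f n) ⟨
      suc n · (Δ f (suc n) + Δ f n)       ≈⟨ ×-distrib-+ _ _ (suc n) ⟩
      suc n · Δ f (suc n) + suc n · Δ f n ∎

    Δ[k·f] : Δ (λ k → k · f k) n ≈ n · Δ f n + Δ Df n
    Δ[k·f] = begin
      Δ (λ k → k · f k) n               ≈⟨ Δ-cong k·f≈D[f∘suc] n ⟩
      Δ (λ k → k · f (suc (k ∸ 1))) n   ≈⟨ Δ-absorb (f ∘ suc) n ⟩
      n · Δ (f ∘ suc) (n ∸ 1)           ≈⟨ step n ⟩
      n · Δ f n + n · Δ f (n ∸ 1)       ≈⟨ +-congˡ (Δ-absorb f n) ⟨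
      n · Δ f n + Δ Df n                ∎

-- Polynomials as coefficient vectors, and affine substitution.

module Polynomials {c ℓ} (K : CommutativeRing c ℓ) where
  open CommutativeRing K hiding (zero)
  open Algebra.Properties.Semiring.Sum semiring
    using (sum-syntax; sum⁺-syntax; sum-cong-≋; *-distribˡ-sum)
  open Algebra.Properties.Semiring.Exp semiring using (_^_; ^-congˡ)
  open Algebra.Solver.Ring.NaturalCoefficients.Default commutativeSemiring
    using (solve; _:=_; _:+_; _:*_)
  open Relation.Binary.Reasoning.Setoid setoid

  -- At length `suc d` and argument `[ x ]` this is the very sum required by `IsQPolynomial`.
  evaluate : ∀ {n} → (Fin n → Carrier) → Carrier → Carrier
  evaluate {n} p y = ∑[ k < n ] (p k * y ^ toℕ k)

  evaluate-cong : ∀ {n} (p : Fin n → Carrier) {y z} → y ≈ z → evaluate p y ≈ evaluate p z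
  evaluate-cong {n} p {y} {z} y≈z =
    sum-cong-≋ {n} {λ k → p k * y ^ toℕ k} {λ k → p k * z ^ toℕ k} λ k →
      *-congˡ (^-congˡ (toℕ k) y≈z)

  horner : ∀ {n} (p : Fin (suc n) → Carrier) y →
    evaluate p y ≈ p zero + y * evaluate (p ∘ suc) y
  horner {n} p y = +-cong (*-identityʳ (p zero)) (begin
    ∑[ k < n ] (p (suc k) * (y * y ^ toℕ k))
      ≈⟨ sum-cong-≋ {n} {λ k → p (suc k) * (y * y ^ toℕ k)} (λ k → solve 3 (λ a y z → a :* (y :* z) := y :* (a :* z))
           refl (p (suc k)) y (y ^ toℕ k)) ⟩
    ∑[ k < n ] (y * (p (suc k) * y ^ toℕ k))  ≈⟨ *-distribˡ-sum {n} y (λ k → p (suc k) * y ^ toℕ k) ⟨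
    y * evaluate (p ∘ suc) y                  ∎)

  cons : ∀ {n} → Carrier → (Fin n → Carrier) → Fin (suc n) → Carrier
  cons a p zero    = a
  cons a p (suc k) = p k

  -- The summand `a` is the carry that makes the recursion close: once the constant term
  -- `a + v * p zero` is split off, the product `w * p zero` moves up one degree and becomes the
  -- carry for the tail.
  linear-*-polynomial : ∀ v w a {n} (p : Fin n → Carrier) →
    Σ[ p′ ∈ (Fin (suc n) → Carrier) ]
      (∀ y → a + (v + w * y) * evaluate p y ≈ evaluate p′ y)
  linear-*-polynomial v w a {zero}  p = (λ _ → a) , λ y → begin
    a + (v + w * y) * 0# ≈⟨ +-cong (sym (*-identityʳ a)) (zeroʳ _) ⟩
    a * 1# + 0#          ∎
  linear-*-polynomial v w a {suc n} p
    with p′ , eq ← linear-*-polynomial v w (w * p zero) (p ∘ suc) =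
    cons (a + v * p zero) p′ , λ y → begin
    a + (v + w * y) * evaluate p y
      ≈⟨ +-congˡ (*-congˡ (horner p y)) ⟩
    a + (v + w * y) * (p zero + y * evaluate (p ∘ suc) y)
      ≈⟨ solve 6 (λ a v w y b e → a :+ (v :+ w :* y) :* (b :+ y :* e)
                    := (a :+ v :* b) :+ y :* (w :* b :+ (v :+ w :* y) :* e))
               refl a v w y (p zero) (evaluate (p ∘ suc) y) ⟩
    (a + v * p zero) + y * (w * p zero + (v + w * y) * evaluate (p ∘ suc) y)
      ≈⟨ +-congˡ (*-congˡ (eq y)) ⟩
    (a + v * p zero) + y * evaluate p′ y
      ≈⟨ horner (cons (a + v * p zero) p′) y ⟨
    evaluate (cons (a + v * p zero) p′) y ∎

  -- Horner's scheme: substitute in the tail, then multiply by `v + w * y` and add `p zero`. The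
  -- product restores the one coefficient that the tail lacks, so the length is kept.
  affine-substitution : ∀ v w {n} (p : Fin n → Carrier) →
    Σ[ p′ ∈ (Fin n → Carrier) ] (∀ y → evaluate p (v + w * y) ≈ evaluate p′ y)
  affine-substitution v w {zero}  p = p , λ _ → refl
  affine-substitution v w {suc n} p
    with p₁ , eq₁ ← affine-substitution v w (p ∘ suc)
    with p₂ , eq₂ ← linear-*-polynomial v w (p zero) p₁ =
    p₂ , λ y → begin
    evaluate p (v + w * y)                                      ≈⟨ horner p _ ⟩
    p zero + (v + w * y) * evaluate (p ∘ suc) (v + w * y)       ≈⟨ +-congˡ (*-congˡ (eq₁ y)) ⟩
    p zero + (v + w * y) * evaluate p₁ y                        ≈⟨ eq₂ y ⟩
    evaluate p₂ y                                               ∎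

-- Powers of q, and Carlitz-type sums as q-polynomials.

module CarlitzSequences {c ℓ₁ ℓ₂ ℓ₃} (R : Reals c ℓ₁ ℓ₂ ℓ₃) {q : Reals.Carrier R}
  (0<q : Reals._<_ R (Reals.0# R) q) (q#1 : Reals._#_ R q (Reals.1# R))
  (q^_ : Reals.Carrier R → Reals.Carrier R) (isPower : IsPower R q q^_) where
  open Reals R hiding (zero)
  open Inverses R using (suc·1-invertible)
  open QPolynomials R q#1 q^_
  open IsPower isPower using (homo; base) renaming (cong to q^-cong)
  open FiniteDifferences commutativeRing
  open Polynomials commutativeRing
  open CommutativeRing commutativeRing using (commutativeSemiring; +-group)
  open Algebra.Properties.Ring ring using (-0#≈0#)
  open Algebra.Properties.Group +-group using () renaming (//-rightDividesˡ to x-y+y≈x)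
  open Algebra.Properties.Semiring.Sum semiring using (sum-cong-≋; *-distribˡ-sum)
  open Algebra.Properties.Semiring.Mult semiring using (×-congʳ; ×-comm-*; ×-assoc-*; ×-homo-1)
  open Algebra.Solver.Ring.NaturalCoefficients.Default commutativeSemiring
    using (solve; _:=_; _:+_; _:*_)
  open Relation.Binary.Reasoning.Setoid setoid

  private
    r : Carrier
    r = [q-1]⁻¹

  r*[q-1]≈1 : r * (q - 1#) ≈ 1#
  r*[q-1]≈1 = proj₁ (proj₂ (#⇒invertible q#1))

  r^suc*[q-1]≈r^ : ∀ n → r ^ suc n * (q - 1#) ≈ r ^ n
  r^suc*[q-1]≈r^ n = begin
    r * r ^ n * (q - 1#)   ≈⟨ solve 3 (λ r s w → r :* s :* w := r :* w :* s) refl r _ _ ⟩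
    r * (q - 1#) * r ^ n   ≈⟨ *-congʳ r*[q-1]≈1 ⟩
    1# * r ^ n             ≈⟨ *-identityˡ _ ⟩
    r ^ n                  ∎

  -- The homomorphism law gives `q * q^ 0# ≈ q`, and `q` can be cancelled: `0 < q` yields `q # 0#`
  -- and hence an inverse.
  q^0≈1 : q^ 0# ≈ 1#
  q^0≈1 with z , z*[q-0]≈1 , _ ← #⇒invertible (Equivalence.from #⇔<⊎> (inj₂ 0<q)) = begin
    q^ 0#                     ≈⟨ *-identityˡ _ ⟨
    1# * q^ 0#                ≈⟨ *-congʳ z*q≈1 ⟨
    z * q * q^ 0#             ≈⟨ *-assoc _ _ _ ⟩
    z * (q * q^ 0#)           ≈⟨ *-congˡ (*-congʳ base) ⟨
    z * (q^ 1# * q^ 0#)       ≈⟨ *-congˡ (homo 1# 0#) ⟨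
    z * q^ (1# + 0#)          ≈⟨ *-congˡ (q^-cong (+-identityʳ 1#)) ⟩
    z * q^ 1#                 ≈⟨ *-congˡ base ⟩
    z * q                     ≈⟨ z*q≈1 ⟩
    1#                        ∎
    where
    z*q≈1 : z * q ≈ 1#
    z*q≈1 = trans (*-congˡ (sym (trans (+-congˡ -0#≈0#) (+-identityʳ q)))) z*[q-0]≈1

  q^-x*q^x≈1 : ∀ x → q^ (- x) * q^ x ≈ 1#
  q^-x*q^x≈1 x = trans (sym (homo (- x) x)) (trans (q^-cong (-‿inverseˡ x)) q^0≈1)

  q^-x*[q^x*y]≈y : ∀ x y → q^ (- x) * (q^ x * y) ≈ y
  q^-x*[q^x*y]≈y x y =
    trans (sym (*-assoc _ _ _)) (trans (*-congʳ (q^-x*q^x≈1 x)) (*-identityˡ y))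

  q^x*[q^-x*y]≈y : ∀ x y → q^ x * (q^ (- x) * y) ≈ y
  q^x*[q^-x*y]≈y x y = trans
    (solve 3 (λ u v y → u :* (v :* y) := v :* (u :* y)) refl (q^ x) (q^ (- x)) y)
    (q^-x*[q^x*y]≈y x y)

  q^[k·x]≈[q^x]^k : ∀ k x → q^ (k · x) ≈ (q^ x) ^ k
  q^[k·x]≈[q^x]^k zero    x = q^0≈1
  q^[k·x]≈[q^x]^k (suc k) x = trans (homo x (k · x)) (*-congˡ (q^[k·x]≈[q^x]^k k x))

  q^x≈1+[q-1]*[x] : ∀ x → q^ x ≈ 1# + (q - 1#) * [ x ]
  q^x≈1+[q-1]*[x] x = begin
    q^ x                                ≈⟨ x-y+y≈x 1# (q^ x) ⟨
    q^ x - 1# + 1#                      ≈⟨ +-comm _ _ ⟩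
    1# + (q^ x - 1#)                    ≈⟨ +-congˡ (*-identityʳ _) ⟨
    1# + (q^ x - 1#) * 1#               ≈⟨ +-congˡ (*-congˡ r*[q-1]≈1) ⟨
    1# + (q^ x - 1#) * (r * (q - 1#))
      ≈⟨ +-congˡ (solve 3 (λ t r w → t :* (r :* w) := w :* (t :* r)) refl _ _ _) ⟩
    1# + (q - 1#) * [ x ]               ∎

  -- Because `q^ (k · x)` is the `k`-th power of `q^ x`, the sum is a polynomial in `q^ x` whose
  -- coefficients do not depend on `x`. Replacing `q^ x` by its affine expression in `[ x ]` keeps
  -- the degree bound `n`.
  carlitz-isQPolynomial : ∀ a n → IsQPolynomial (carlitz a n)
  carlitz-isQPolynomial a n = n , proj₁ substitution , λ x → begin
    carlitz a n x
      ≈⟨ *-distribˡ-sum {suc n} (r ^ n) (λ k → signedTerm (λ k → a k * q^ (k · x)) n (toℕ k)) ⟩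
    ∑[ k ≤ n ] (r ^ n * signedTerm (λ k → a k * q^ (k · x)) n (toℕ k))
      ≈⟨ sum-cong-≋ {suc n} {λ k → r ^ n * signedTerm (λ k → a k * q^ (k · x)) n (toℕ k)} (λ k → monomial x (toℕ k)) ⟩
    evaluate coefficients (q^ x)
      ≈⟨ evaluate-cong coefficients (q^x≈1+[q-1]*[x] x) ⟩
    evaluate coefficients (1# + (q - 1#) * [ x ])
      ≈⟨ proj₂ substitution [ x ] ⟩
    evaluate (proj₁ substitution) [ x ] ∎
    where
    coefficients : Fin (suc n) → Carrier
    coefficients k = r ^ n * signedTerm a n (toℕ k)

    substitution : Σ[ b ∈ (Fin (suc n) → Carrier) ]
      (∀ y → evaluate coefficients (1# + (q - 1#) * y) ≈ evaluate b y)
    substitution = affine-substitution 1# (q - 1#) coefficients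

    monomial : ∀ x k → r ^ n * signedTerm (λ k → a k * q^ (k · x)) n k
                     ≈ r ^ n * signedTerm a n k * (q^ x) ^ k
    monomial x k = begin
      r ^ n * ((- 1#) ^ (n ∸ k) * ((n C k) · (a k * q^ (k · x))))
        ≈⟨ *-congˡ (*-congˡ (×-assoc-* (n C k) (a k) _)) ⟨
      r ^ n * ((- 1#) ^ (n ∸ k) * ((n C k) · a k * q^ (k · x)))
        ≈⟨ *-congˡ (*-congˡ (*-congˡ (q^[k·x]≈[q^x]^k k x))) ⟩
      r ^ n * ((- 1#) ^ (n ∸ k) * ((n C k) · a k * (q^ x) ^ k))
        ≈⟨ solve 4 (λ r s t u → r :* (s :* (t :* u)) := r :* (s :* t) :* u) refl _ _ _ _ ⟩
      r ^ n * signedTerm a n k * (q^ x) ^ k ∎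

  -- Reduces each of the four claims to its expansion formula.
  isCarlitzType : ∀ {T a} → (∀ n x → T n x ≈ carlitz a n x) → IsCarlitzType T a
  isCarlitzType {T} {a} T≈ = record
    { isQPolynomial = λ n → let d , b , eq = carlitz-isQPolynomial a n
                            in d , b , λ x → trans (T≈ n x) (eq x)
    ; expansion     = T≈
    }

  -- The difference rules carried over to Carlitz-type sums.

  carlitz-cong : ∀ {a b} → (∀ k → a k ≈ b k) → ∀ n x → carlitz a n x ≈ carlitz b n x
  carlitz-cong {a} {b} a≈b n x = *-congˡ
    (Δ-cong {λ k → a k * q^ (k · x)} {λ k → b k * q^ (k · x)} (λ k → *-congʳ (a≈b k)) n)

  -- This is `Δ-absorb` for `F k = a k * q^ (k · x)`, with two corrections: the factor `q - 1#`
  -- accounts for the change of prefactor from `r ^ (n ∸ 1)` to `r ^ n`, and `q^ x` raises the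
  -- exponent in `F (k ∸ 1)` to `k · x`.
  carlitz-absorb : ∀ a n x →
    q^ x * (n · carlitz a (n ∸ 1) x) ≈ carlitz (λ k → (q - 1#) * (k · a (k ∸ 1))) n x
  carlitz-absorb a n x = begin
    q^ x * (n · carlitz a (n ∸ 1) x)
      ≈⟨ *-congˡ (×-comm-* n _ _) ⟨
    q^ x * (r ^ (n ∸ 1) * (n · Δ F (n ∸ 1)))
      ≈⟨ scale n ⟩
    r ^ n * ((q - 1#) * q^ x * (n · Δ F (n ∸ 1)))
      ≈⟨ *-congˡ (*-congˡ (Δ-absorb F n)) ⟨
    r ^ n * ((q - 1#) * q^ x * Δ (λ k → k · F (k ∸ 1)) n)
      ≈⟨ *-congˡ (Δ-*-homo _ (λ k → k · F (k ∸ 1)) n) ⟨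
    r ^ n * Δ (λ k → (q - 1#) * q^ x * (k · F (k ∸ 1))) n
      ≈⟨ *-congˡ (Δ-cong term n) ⟩
    carlitz (λ k → (q - 1#) * (k · a (k ∸ 1))) n x ∎
    where
    F : ℕ → Carrier
    F k = a k * q^ (k · x)

    -- At `n = 0` the index `n ∸ 1` truncates to 0 and the prefactors do not match, but the multiple
    -- `0 · _` annihilates both sides.
    scale : ∀ n → q^ x * (r ^ (n ∸ 1) * (n · Δ F (n ∸ 1)))
                ≈ r ^ n * ((q - 1#) * q^ x * (n · Δ F (n ∸ 1)))
    scale zero    = begin
      q^ x * (1# * 0#)              ≈⟨ *-congˡ (zeroʳ 1#) ⟩
      q^ x * 0#                     ≈⟨ zeroʳ _ ⟩
      0#                            ≈⟨ zeroʳ 1# ⟨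
      1# * 0#                       ≈⟨ *-congˡ (zeroʳ _) ⟨
      1# * ((q - 1#) * q^ x * 0#)   ∎
    scale (suc n) = begin
      q^ x * (r ^ n * D)                       ≈⟨ *-congˡ (*-congʳ (r^suc*[q-1]≈r^ n)) ⟨
      q^ x * (r ^ suc n * (q - 1#) * D)
        ≈⟨ solve 4 (λ u r w d → u :* (r :* w :* d) := r :* (w :* u :* d)) refl _ _ _ _ ⟩
      r ^ suc n * ((q - 1#) * q^ x * D)        ∎
      where
      D : Carrier
      D = suc n · Δ F n

    term : ∀ k → (q - 1#) * q^ x * (k · F (k ∸ 1))
               ≈ (q - 1#) * (k · a (k ∸ 1)) * q^ (k · x)
    term zero    = begin
      (q - 1#) * q^ x * 0#        ≈⟨ zeroʳ _ ⟩
      0#                          ≈⟨ zeroˡ _ ⟨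
      0# * q^ 0#                  ≈⟨ *-congʳ (zeroʳ _) ⟨
      (q - 1#) * 0# * q^ 0#       ∎
    term (suc k) = begin
      (q - 1#) * q^ x * (suc k · (a k * q^ (k · x)))   ≈⟨ *-congˡ (×-assoc-* (suc k) _ _) ⟨
      (q - 1#) * q^ x * (suc k · a k * q^ (k · x))
        ≈⟨ solve 4 (λ w u b e → w :* u :* (b :* e) := w :* b :* (u :* e)) refl _ _ (suc k · a k) _ ⟩
      (q - 1#) * (suc k · a k) * (q^ x * q^ (k · x))   ≈⟨ *-congˡ (homo x (k · x)) ⟨
      (q - 1#) * (suc k · a k) * q^ (suc k · x)        ∎

  -- The factor `q - 1#` turns the prefactor `r ^ suc n` into `r ^ n`, so that `Δ-suc` applies to
  -- the two differences. The power `q^ x` then comes out of every term of the shifted sequence.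
  carlitz-shift : ∀ a n x →
    carlitz a n x + (q - 1#) * carlitz a (suc n) x ≈ q^ x * carlitz (a ∘ suc) n x
  carlitz-shift a n x = begin
    r ^ n * Δ F n + (q - 1#) * (r ^ suc n * Δ F (suc n))
      ≈⟨ +-congˡ (solve 3 (λ w s d → w :* (s :* d) := s :* w :* d) refl _ _ _) ⟩
    r ^ n * Δ F n + r ^ suc n * (q - 1#) * Δ F (suc n)
      ≈⟨ +-congˡ (*-congʳ (r^suc*[q-1]≈r^ n)) ⟩
    r ^ n * Δ F n + r ^ n * Δ F (suc n)
      ≈⟨ solve 3 (λ s d e → s :* d :+ s :* e := s :* (e :+ d)) refl _ _ _ ⟩
    r ^ n * (Δ F (suc n) + Δ F n)
      ≈⟨ *-congˡ (Δ-suc F n) ⟩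
    r ^ n * Δ (F ∘ suc) n
      ≈⟨ *-congˡ (Δ-cong term n) ⟩
    r ^ n * Δ (λ k → q^ x * (a (suc k) * q^ (k · x))) n
      ≈⟨ *-congˡ (Δ-*-homo (q^ x) (λ k → a (suc k) * q^ (k · x)) n) ⟩
    r ^ n * (q^ x * Δ (λ k → a (suc k) * q^ (k · x)) n)
      ≈⟨ solve 3 (λ s u d → s :* (u :* d) := u :* (s :* d)) refl _ _ _ ⟩
    q^ x * carlitz (a ∘ suc) n x ∎
    where
    F : ℕ → Carrier
    F k = a k * q^ (k · x)

    term : ∀ k → F (suc k) ≈ q^ x * (a (suc k) * q^ (k · x))
    term k = trans (*-congˡ (homo x (k · x)))
      (solve 3 (λ a u e → a :* (u :* e) := u :* (a :* e)) refl _ _ _)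

  -- Division by n + 1, and the four transformed sequences.

  /1+-·-cancel : ∀ n y → (suc n · y) /1+ n ≈ y
  /1+-·-cancel n y = begin
    suc n · y * z               ≈⟨ *-congʳ (×-congʳ (suc n) (*-identityˡ y)) ⟨
    suc n · (1# * y) * z        ≈⟨ *-congʳ (×-assoc-* (suc n) 1# y) ⟨
    suc n · 1# * y * z          ≈⟨ solve 3 (λ m y z → m :* y :* z := y :* (z :* m)) refl (suc n · 1#) y z ⟩
    y * (z * suc n · 1#)        ≈⟨ *-congˡ (proj₁ (proj₂ (suc·1-invertible n))) ⟩
    y * 1#                      ≈⟨ *-identityʳ y ⟩
    y                           ∎
    where
    z : Carrier
    z = proj₁ (suc·1-invertible n)

  ·-/1+-cancel : ∀ n y → suc n · (y /1+ n) ≈ y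
  ·-/1+-cancel n y = trans (sym (×-assoc-* (suc n) y _)) (/1+-·-cancel n y)

  module _ {T : ℕ → Carrier → Carrier} {a : ℕ → Carrier} (T-carlitz : IsCarlitzType T a) where
    open IsCarlitzType T-carlitz using (expansion)

    absorbed : IsCarlitzType (λ n x → (q^ x) * (n · T (n ∸ 1) x))
                             (λ k → (q - 1#) * (k · a (k ∸ 1)))
    absorbed = isCarlitzType λ n x →
      trans (*-congˡ (×-congʳ n (expansion (n ∸ 1) x))) (carlitz-absorb a n x)

    -- The expansion of `T 0` is the constant `a 0 * q^ 0#`, so its value at a single point
    -- determines `a 0`.
    T₀≈0⇒a₀≈0 : (∀ x → T 0 x ≈ 0#) → a 0 ≈ 0#
    T₀≈0⇒a₀≈0 T₀≈0 = begin
      a 0                                       ≈⟨ *-identityʳ _ ⟨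
      a 0 * 1#                                  ≈⟨ *-congˡ q^0≈1 ⟨
      a 0 * q^ 0#                               ≈⟨ ×-homo-1 _ ⟨
      1 · (a 0 * q^ 0#)                         ≈⟨ *-identityˡ _ ⟨
      1# * (1 · (a 0 * q^ 0#))                  ≈⟨ +-identityʳ _ ⟨
      1# * (1 · (a 0 * q^ 0#)) + 0#             ≈⟨ *-identityˡ _ ⟨
      carlitz a 0 0#                            ≈⟨ expansion 0 0# ⟨
      T 0 0#                                    ≈⟨ T₀≈0 0# ⟩
      0#                                        ∎

    -- `carlitz-absorb` is read backwards at index `suc n`, where the multiple `suc n` and the power
    -- `q^ x` can both be cancelled.
    unabsorbed : (∀ x → T 0 x ≈ 0#) →
      IsCarlitzType (λ n x → ((q^ (- x)) * T (suc n) x) /1+ n)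
                    (λ k → r * (a (suc k) /1+ k))
    unabsorbed T₀≈0 = isCarlitzType λ n x → begin
      (q^ (- x) * T (suc n) x) /1+ n
        ≈⟨ *-congʳ (*-congˡ (expansion (suc n) x)) ⟩
      (q^ (- x) * carlitz a (suc n) x) /1+ n
        ≈⟨ *-congʳ (*-congˡ (carlitz-cong a≈absorbed-b (suc n) x)) ⟩
      (q^ (- x) * carlitz (λ k → (q - 1#) * (k · b (k ∸ 1))) (suc n) x) /1+ n
        ≈⟨ *-congʳ (*-congˡ (carlitz-absorb b (suc n) x)) ⟨
      (q^ (- x) * (q^ x * (suc n · carlitz b n x))) /1+ n
        ≈⟨ *-congʳ (q^-x*[q^x*y]≈y x _) ⟩
      (suc n · carlitz b n x) /1+ n
        ≈⟨ /1+-·-cancel n _ ⟩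
      carlitz b n x ∎
      where
      b : ℕ → Carrier
      b k = r * (a (suc k) /1+ k)

      a≈absorbed-b : ∀ k → a k ≈ (q - 1#) * (k · b (k ∸ 1))
      -- The transform of part 1 always vanishes at index 0, so recovering `a` there requires
      -- `a 0 ≈ 0#`.
      a≈absorbed-b zero    = trans (T₀≈0⇒a₀≈0 T₀≈0) (sym (zeroʳ _))
      a≈absorbed-b (suc k) = sym (begin
        (q - 1#) * (suc k · (r * (a (suc k) /1+ k)))   ≈⟨ *-congˡ (×-comm-* (suc k) r _) ⟨
        (q - 1#) * (r * (suc k · (a (suc k) /1+ k)))   ≈⟨ *-congˡ (*-congˡ (·-/1+-cancel k _)) ⟩
        (q - 1#) * (r * a (suc k))
          ≈⟨ solve 3 (λ w r y → w :* (r :* y) := r :* w :* y) refl _ _ _ ⟩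
        r * (q - 1#) * a (suc k)                       ≈⟨ *-congʳ r*[q-1]≈1 ⟩
        1# * a (suc k)                                 ≈⟨ *-identityˡ _ ⟩
        a (suc k)                                      ∎)

    shifted : IsCarlitzType (λ n x → (q^ (- x)) * (T n x + (q - 1#) * T (suc n) x))
                            (λ k → a (suc k))
    shifted = isCarlitzType λ n x → begin
      q^ (- x) * (T n x + (q - 1#) * T (suc n) x)
        ≈⟨ *-congˡ (+-cong (expansion n x) (*-congˡ (expansion (suc n) x))) ⟩
      q^ (- x) * (carlitz a n x + (q - 1#) * carlitz a (suc n) x)
        ≈⟨ *-congˡ (carlitz-shift a n x) ⟩
      q^ (- x) * (q^ x * carlitz (a ∘ suc) n x)
        ≈⟨ q^-x*[q^x*y]≈y x _ ⟩
      carlitz (a ∘ suc) n x ∎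

  -- The factor `q^ x` brought in by `absorbed` cancels the `q^ (- x)` brought in by `shifted`.
  shifted-absorbed : ∀ {T a} → IsCarlitzType T a →
    IsCarlitzType (λ n x → n · (T (n ∸ 1) x + (q - 1#) * T n x))
                  (λ k → (q - 1#) * (k · a k))
  shifted-absorbed {T} {a} T-carlitz = isCarlitzType λ n x → begin
    n · (T (n ∸ 1) x + (q - 1#) * T n x)
      ≈⟨ unshift n x ⟩
    q^ x * (n · (q^ (- x) * (T (n ∸ 1) x + (q - 1#) * T (suc (n ∸ 1)) x)))
      ≈⟨ IsCarlitzType.expansion (absorbed (shifted T-carlitz)) n x ⟩
    carlitz (λ k → (q - 1#) * (k · a (suc (k ∸ 1)))) n x
      ≈⟨ carlitz-cong {λ k → (q - 1#) * (k · a (suc (k ∸ 1)))} {λ k → (q - 1#) * (k · a k)}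
           (λ { zero → refl ; (suc k) → refl }) n x ⟩
    carlitz (λ k → (q - 1#) * (k · a k)) n x ∎
    where
    -- Composing the two parts produces `T (suc (n ∸ 1))`, which is `T n` except at `n = 0`, where
    -- the factor `n` makes both sides zero.
    unshift : ∀ n x → n · (T (n ∸ 1) x + (q - 1#) * T n x)
      ≈ q^ x * (n · (q^ (- x) * (T (n ∸ 1) x + (q - 1#) * T (suc (n ∸ 1)) x)))
    unshift zero    x = sym (zeroʳ _)
    unshift (suc n) x = begin
      suc n · V                             ≈⟨ ×-congʳ (suc n) (q^x*[q^-x*y]≈y x V) ⟨
      suc n · (q^ x * (q^ (- x) * V))       ≈⟨ ×-comm-* (suc n) _ _ ⟨
      q^ x * (suc n · (q^ (- x) * V))       ∎
      where
      V : Carrier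
      V = T n x + (q - 1#) * T (suc n) x

proposition2p11 : ∀ {c ℓ₁ ℓ₂ ℓ₃} (R : Reals c ℓ₁ ℓ₂ ℓ₃) →
    let open Reals R in
    (q : Carrier) → 0# < q → (q#1 : q # 1#) →
    (q^_ : Carrier → Carrier) → IsPower R q q^_ →
    let open QPolynomials R q#1 q^_ in
    (T : ℕ → Carrier → Carrier) (a : ℕ → Carrier) → IsCarlitzType T a →
      IsCarlitzType (λ n x → (q^ x) * (n · T (n ∸ 1) x))
                    (λ k → (q - 1#) * (k · a (k ∸ 1)))
    × ((∀ x → T 0 x ≈ 0#) →
       IsCarlitzType (λ n x → ((q^ (- x)) * T (suc n) x) /1+ n)
                     (λ k → [q-1]⁻¹ * (a (suc k) /1+ k)))
    × IsCarlitzType (λ n x → (q^ (- x)) * (T n x + (q - 1#) * T (suc n) x))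
                    (λ k → a (suc k))
    × IsCarlitzType (λ n x → n · (T (n ∸ 1) x + (q - 1#) * T n x))
                    (λ k → (q - 1#) * (k · a k))
proposition2p11 R q 0<q q#1 q^_ isPower T a T-carlitz =
  absorbed T-carlitz , unabsorbed T-carlitz , shifted T-carlitz , shifted-absorbed T-carlitz
  where open CarlitzSequences R 0<q q#1 q^_ isPower
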